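{- For any $\alpha>0$, integers $n,m$ with $m>n$, $n$ dividing $m$ and $m/n>2$, and $k$ with $n\le k\le m$, there exists a full rank matrix $X\in\mathbb{R}^{n\times m}$ such that for every subset $\mathcal S\subseteq[m]$ of cardinality $k$ with $\mathrm{rank}(X_{\mathcal S})=n$, $$\|X_{\mathcal S}^{\dagger}\|_F^2\ge\Big(\frac{m-k}{k+\alpha^2}+1-\frac{k}{n}\Big)\|X^{\dagger}\|_F^2 .$$
   Context: $[m]=\{1,\dots,m\}$; $X_{\mathcal S}$ is the submatrix of columns of $X$ indexed by $\mathcal S$; $A^\dagger$ is the Moore–Penrose pseudo-inverse; $\|\cdot\|_F$ is the Frobenius norm. -}

module Defs where

open import Algebra.Bundles using (CommutativeRing)
import Algebra.Properties.Semiring.Sum as SemiringSum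
open import Data.Bool.Base using (true; false)
open import Data.Fin.Base using (Fin; zero; suc)
open import Data.Fin.Subset using (Subset; ∣_∣)
open import Data.Integer.Base using (+_)
open import Data.Nat.Base as ℕ using (ℕ; suc; NonZero)
import Data.Nat.Properties as ℕₚ
open import Data.Product.Base using (∃-syntax; Σ-syntax; _×_; _,_)
open import Data.Rational.Base as ℚ using (ℚ; 0ℚ; 1ℚ; ½)
import Data.Rational.Properties as ℚₚ
import Data.Rational.Solver as ℚSolver
open import Data.Vec.Base using ([]; _∷_)
open import Data.Vec.Functional using (Vector)
open import Function.Base using (_∘_; _$_)
open import Level using (0ℓ; _⊔_)
open import Relation.Binary.PropositionalEquality as ≡ using (_≡_; refl; cong; sym; subst)
open import Relation.Binary.Structures using (IsEquivalence)
open import Relation.Nullary using (yes; no; contradiction)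

------------------------------------------------------------------------
-- The real numbers, as Cauchy sequences of rationals.  There are no
-- quotient types, so equality of reals is the setoid relation _≈_
-- (the difference tends to 0).

Eventually : (ℕ → Set) → Set
Eventually P = ∃[ N ] (∀ n → N ℕ.≤ n → P n)

dist : ℚ → ℚ → ℚ
dist p q = ℚ.∣ p ℚ.- q ∣

Cauchy : (ℕ → ℚ) → Set
Cauchy s = ∀ ε → 0ℚ ℚ.< ε →
  ∃[ N ] (∀ i j → N ℕ.≤ i → N ℕ.≤ j → dist (s i) (s j) ℚ.< ε)

record ℝ : Set where
  constructor mkℝ
  field
    seq    : ℕ → ℚ
    cauchy : Cauchy seq

open ℝ public

infix 4 _≈_ _<_ _≤_

_≈_ : ℝ → ℝ → Set
x ≈ y = ∀ ε → 0ℚ ℚ.< ε → Eventually λ n → dist (seq x n) (seq y n) ℚ.< ε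

_<_ : ℝ → ℝ → Set
x < y = ∃[ ε ] (0ℚ ℚ.< ε × Eventually λ n → seq x n ℚ.+ ε ℚ.< seq y n)

_≤_ : ℝ → ℝ → Set
x ≤ y = ∀ ε → 0ℚ ℚ.< ε → Eventually λ n → seq x n ℚ.< seq y n ℚ.+ ε

private
  open ℚSolver.+-*-Solver

  *-pos : ∀ {p q} → 0ℚ ℚ.< p → 0ℚ ℚ.< q → 0ℚ ℚ.< p ℚ.* q
  *-pos {p} {q} 0<p 0<q = ℚₚ.positive⁻¹ (p ℚ.* q)
    {{ℚₚ.pos*pos⇒pos p {{ℚ.positive 0<p}} q {{ℚ.positive 0<q}}}}

  opaque
    0<1 : 0ℚ ℚ.< 1ℚ
    0<1 = ℚₚ.positive⁻¹ 1ℚ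

    half : ℚ → ℚ
    half ε = ½ ℚ.* ε

    half-pos : ∀ {ε} → 0ℚ ℚ.< ε → 0ℚ ℚ.< half ε
    half-pos = *-pos (ℚₚ.positive⁻¹ ½)

    half+half : ∀ ε → half ε ℚ.+ half ε ≡ ε
    half+half ε = ≡.trans (sym (ℚₚ.*-distribʳ-+ ε ½ ½)) (ℚₚ.*-identityˡ ε)

  halves : ∀ {p q} ε → p ℚ.< half ε → q ℚ.< half ε → p ℚ.+ q ℚ.< ε
  halves ε p< q< = subst (_ ℚ.<_) (half+half ε) (ℚₚ.+-mono-< p< q<)

  opaque
    solve-for : ∀ {b} ε → 0ℚ ℚ.< b → 0ℚ ℚ.< ε → ∃[ δ ] (0ℚ ℚ.< δ × b ℚ.* δ ≡ ε)
    solve-for {b} ε 0<b 0<ε =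
      1/b ℚ.* ε ,
      *-pos (ℚₚ.positive⁻¹ 1/b {{ℚₚ.1/pos⇒pos b {{ℚ.positive 0<b}}}}) 0<ε ,
      ≡.trans (sym (ℚₚ.*-assoc b 1/b ε))
        (≡.trans (cong (ℚ._* ε) (ℚₚ.*-inverseʳ b {{b≢0}})) (ℚₚ.*-identityˡ ε))
      where
      b≢0 : ℚ.NonZero b
      b≢0 = ℚ.>-nonZero 0<b
      1/b : ℚ
      1/b = (ℚ.1/ b) {{b≢0}}

  dist-refl : ∀ p → dist p p ≡ 0ℚ
  dist-refl p = cong ℚ.∣_∣ (ℚₚ.+-inverseʳ p)

  dist-sym : ∀ p q → dist p q ≡ dist q p
  dist-sym p q = ≡.trans
    (cong ℚ.∣_∣ (solve 2 (λ p q → p :- q := :- (q :- p)) refl p q))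
    (ℚₚ.∣-p∣≡∣p∣ (q ℚ.- p))

  dist-triangle : ∀ p q r → dist p r ℚ.≤ dist p q ℚ.+ dist q r
  dist-triangle p q r = subst (ℚ._≤ dist p q ℚ.+ dist q r)
    (cong ℚ.∣_∣ (solve 3 (λ p q r → (p :- q) :+ (q :- r) := p :- r) refl p q r))
    (ℚₚ.∣p+q∣≤∣p∣+∣q∣ (p ℚ.- q) (q ℚ.- r))

  dist-+ : ∀ p q r s → dist (p ℚ.+ q) (r ℚ.+ s) ℚ.≤ dist p r ℚ.+ dist q s
  dist-+ p q r s = subst (ℚ._≤ dist p r ℚ.+ dist q s)
    (cong ℚ.∣_∣ (solve 4 (λ p q r s → (p :- r) :+ (q :- s) := (p :+ q) :- (r :+ s)) refl p q r s))
    (ℚₚ.∣p+q∣≤∣p∣+∣q∣ (p ℚ.- r) (q ℚ.- s))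

  dist-neg : ∀ p q → dist (ℚ.- p) (ℚ.- q) ≡ dist p q
  dist-neg p q = ≡.trans
    (cong ℚ.∣_∣ (solve 2 (λ p q → (:- p) :- (:- q) := :- (p :- q)) refl p q))
    (ℚₚ.∣-p∣≡∣p∣ (p ℚ.- q))

  *-mono-≤-abs : ∀ {p q r s} → ℚ.∣ p ∣ ℚ.≤ r → ℚ.∣ q ∣ ℚ.≤ s → ℚ.∣ p ℚ.* q ∣ ℚ.≤ r ℚ.* s
  *-mono-≤-abs {p} {q} {r} {s} p≤r q≤s =
    subst (ℚ._≤ r ℚ.* s) (sym (ℚₚ.∣p*q∣≡∣p∣*∣q∣ p q)) $
    ℚₚ.≤-trans
      (ℚₚ.*-monoʳ-≤-nonNeg ℚ.∣ q ∣ {{ℚₚ.∣-∣-nonNeg q}} p≤r)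
      (ℚₚ.*-monoˡ-≤-nonNeg r {{ℚ.nonNegative (ℚₚ.≤-trans (ℚₚ.0≤∣p∣ p) p≤r)}} q≤s)

  dist-* : ∀ {p q r s b δ} ε → 0ℚ ℚ.< ε → ℚ.∣ p ∣ ℚ.≤ b → ℚ.∣ s ∣ ℚ.≤ b →
           b ℚ.* δ ≡ half (half ε) → dist p r ℚ.< δ → dist q s ℚ.< δ →
           dist (p ℚ.* q) (r ℚ.* s) ℚ.< ε
  dist-* {p} {q} {r} {s} {b} {δ} ε 0<ε p≤b s≤b bδ p~r q~s =
    ℚₚ.≤-<-trans
      (subst (ℚ._≤ ℚ.∣ p ℚ.* (q ℚ.- s) ∣ ℚ.+ ℚ.∣ s ℚ.* (p ℚ.- r) ∣)
        (cong ℚ.∣_∣ (solve 4 (λ p q r s → p :* (q :- s) :+ s :* (p :- r) := p :* q :- r :* s) refl p q r s))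
        (ℚₚ.∣p+q∣≤∣p∣+∣q∣ (p ℚ.* (q ℚ.- s)) (s ℚ.* (p ℚ.- r))))
      (halves ε (small p≤b q~s) (small s≤b p~r))
    where
    quarter<half : half (half ε) ℚ.< half ε
    quarter<half = subst (half (half ε) ℚ.<_) (half+half (half ε))
      (subst (ℚ._< half (half ε) ℚ.+ half (half ε)) (ℚₚ.+-identityʳ _)
        (ℚₚ.+-monoʳ-< (half (half ε)) (half-pos (half-pos 0<ε))))

    small : ∀ {u v} → ℚ.∣ u ∣ ℚ.≤ b → ℚ.∣ v ∣ ℚ.< δ → ℚ.∣ u ℚ.* v ∣ ℚ.< half ε
    small {u} {v} u≤b v<δ = ℚₚ.≤-<-trans
      (subst (ℚ.∣ u ℚ.* v ∣ ℚ.≤_) bδ (*-mono-≤-abs u≤b (ℚₚ.<⇒≤ v<δ)))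
      quarter<half

  both : ∀ {P Q : ℕ → Set} → Eventually P → Eventually Q → Eventually λ n → P n × Q n
  both (M , p) (N , q) = M ℕ.⊔ N , λ n M⊔N≤n →
    p n (ℕₚ.m⊔n≤o⇒m≤o M N M⊔N≤n) , q n (ℕₚ.m⊔n≤o⇒n≤o M N M⊔N≤n)

  eventually-map : ∀ {P Q : ℕ → Set} → (∀ n → P n → Q n) → Eventually P → Eventually Q
  eventually-map f (N , p) = N , λ n N≤n → f n (p n N≤n)

  opaque
    bound : ∀ s → Cauchy s → ∃[ b ] (0ℚ ℚ.< b × Eventually λ n → ℚ.∣ s n ∣ ℚ.≤ b)
    bound s c = let N , close = c 1ℚ 0<1 in 1ℚ ℚ.+ ℚ.∣ s N ∣ ,
      ℚₚ.+-mono-<-≤ 0<1 (ℚₚ.0≤∣p∣ (s N)) ,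
      N , λ n N≤n → ℚₚ.≤-trans
        (subst (ℚ._≤ dist (s n) (s N) ℚ.+ ℚ.∣ s N ∣)
          (cong ℚ.∣_∣ (solve 2 (λ p q → (p :- q) :+ q := p) refl (s n) (s N)))
          (ℚₚ.∣p+q∣≤∣p∣+∣q∣ (s n ℚ.- s N) (s N)))
        (ℚₚ.+-monoˡ-≤ ℚ.∣ s N ∣ (ℚₚ.<⇒≤ (close n N N≤n ℕₚ.≤-refl)))

  opaque
    common-bound : ∀ s t → Cauchy s → Cauchy t →
      ∃[ b ] (0ℚ ℚ.< b × Eventually λ n → ℚ.∣ s n ∣ ℚ.≤ b × ℚ.∣ t n ∣ ℚ.≤ b)
    common-bound s t cs ct with bound s cs | bound t ct
    ... | b , 0<b , es | c , 0<c , et = b ℚ.⊔ c , ℚₚ.<-≤-trans 0<b (ℚₚ.p≤p⊔q b c) ,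
      eventually-map (λ _ (s≤b , t≤c) →
        ℚₚ.≤-trans s≤b (ℚₚ.p≤p⊔q b c) , ℚₚ.≤-trans t≤c (ℚₚ.p≤q⊔p b c)) (both es et)

fromℚ : ℚ → ℝ
fromℚ q = mkℝ (λ _ → q) λ ε 0<ε → 0 , λ _ _ _ _ → subst (ℚ._< ε) (sym (dist-refl q)) 0<ε

fromℕ : ℕ → ℝ
fromℕ n = fromℚ (+ n ℚ./ 1)

0ℝ 1ℝ : ℝ
0ℝ = fromℚ 0ℚ
1ℝ = fromℚ 1ℚ

infixl 6 _+_ _-_
infixl 7 _*_
infix  8 -_ _²

_+_ : ℝ → ℝ → ℝ
mkℝ s cs + mkℝ t ct = mkℝ (λ n → s n ℚ.+ t n) c
  where
  c : Cauchy (λ n → s n ℚ.+ t n)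
  c ε 0<ε with cs (half ε) (half-pos 0<ε) | ct (half ε) (half-pos 0<ε)
  ... | M , ps | N , pt = M ℕ.⊔ N , λ i j ≤i ≤j → ℚₚ.≤-<-trans
    (dist-+ (s i) (t i) (s j) (t j))
    (halves ε
      (ps i j (ℕₚ.m⊔n≤o⇒m≤o M N ≤i) (ℕₚ.m⊔n≤o⇒m≤o M N ≤j))
      (pt i j (ℕₚ.m⊔n≤o⇒n≤o M N ≤i) (ℕₚ.m⊔n≤o⇒n≤o M N ≤j)))

-_ : ℝ → ℝ
- mkℝ s cs = mkℝ (λ n → ℚ.- s n) λ ε 0<ε → let N , p = cs ε 0<ε in
  N , λ i j ≤i ≤j → subst (ℚ._< ε) (sym (dist-neg (s i) (s j))) (p i j ≤i ≤j)

_-_ : ℝ → ℝ → ℝ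
x - y = x + (- y)

_*_ : ℝ → ℝ → ℝ
mkℝ s cs * mkℝ t ct = mkℝ (λ n → s n ℚ.* t n) c
  where
  c : Cauchy (λ n → s n ℚ.* t n)
  c ε 0<ε with common-bound s t cs ct
  ... | b , 0<b , K , pb with solve-for (half (half ε)) 0<b (half-pos (half-pos 0<ε))
  ... | δ , 0<δ , bδ with cs δ 0<δ | ct δ 0<δ
  ... | M , ps | N , pt = K ℕ.⊔ (M ℕ.⊔ N) , λ i j ≤i ≤j →
    let Mi = ℕₚ.m⊔n≤o⇒n≤o K _ ≤i
        Mj = ℕₚ.m⊔n≤o⇒n≤o K _ ≤j
        si≤b , _ = pb i (ℕₚ.m⊔n≤o⇒m≤o K _ ≤i)
        _ , tj≤b = pb j (ℕₚ.m⊔n≤o⇒m≤o K _ ≤j)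
    in dist-* ε 0<ε si≤b tj≤b bδ
      (ps i j (ℕₚ.m⊔n≤o⇒m≤o M N Mi) (ℕₚ.m⊔n≤o⇒m≤o M N Mj))
      (pt i j (ℕₚ.m⊔n≤o⇒n≤o M N Mi) (ℕₚ.m⊔n≤o⇒n≤o M N Mj))

_² : ℝ → ℝ
x ² = x * x

private
  pointwise : ∀ {x y} → (∀ n → seq x n ≡ seq y n) → x ≈ y
  pointwise {x} {y} eq ε 0<ε = 0 , λ n _ →
    subst (λ q → dist (seq x n) q ℚ.< ε) (eq n)
      (subst (ℚ._< ε) (sym (dist-refl (seq x n))) 0<ε)

  ≈-isEquivalence : IsEquivalence _≈_
  ≈-isEquivalence = record
    { refl  = λ {x} → pointwise {x} {x} (λ _ → refl)
    ; sym   = λ {x} {y} x≈y ε 0<ε → eventually-map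
        (λ n → subst (ℚ._< ε) (dist-sym (seq x n) (seq y n))) (x≈y ε 0<ε)
    ; trans = λ {x} {y} {z} x≈y y≈z ε 0<ε → eventually-map
        (λ n (p , q) → ℚₚ.≤-<-trans (dist-triangle (seq x n) (seq y n) (seq z n)) (halves ε p q))
        (both (x≈y (half ε) (half-pos 0<ε)) (y≈z (half ε) (half-pos 0<ε)))
    }

  +-cong : ∀ {x y u v} → x ≈ y → u ≈ v → (x + u) ≈ (y + v)
  +-cong {x} {y} {u} {v} x≈y u≈v ε 0<ε = eventually-map
    (λ n (p , q) → ℚₚ.≤-<-trans (dist-+ (seq x n) (seq u n) (seq y n) (seq v n)) (halves ε p q))
    (both (x≈y (half ε) (half-pos 0<ε)) (u≈v (half ε) (half-pos 0<ε)))

  -‿cong : ∀ {x y} → x ≈ y → - x ≈ - y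
  -‿cong {x} {y} x≈y ε 0<ε = eventually-map
    (λ n → subst (ℚ._< ε) (sym (dist-neg (seq x n) (seq y n)))) (x≈y ε 0<ε)

  *-cong : ∀ {x y u v} → x ≈ y → u ≈ v → (x * u) ≈ (y * v)
  *-cong {x} {y} {u} {v} x≈y u≈v ε 0<ε with common-bound (seq x) (seq v) (cauchy x) (cauchy v)
  ... | b , 0<b , eb with solve-for (half (half ε)) 0<b (half-pos (half-pos 0<ε))
  ... | δ , 0<δ , bδ = eventually-map
    (λ n ((x≤b , v≤b) , (p , q)) → dist-* ε 0<ε x≤b v≤b bδ p q)
    (both eb (both (x≈y δ 0<δ) (u≈v δ 0<δ)))

ℝ-commutativeRing : CommutativeRing 0ℓ 0ℓ
ℝ-commutativeRing = record
  { Carrier = ℝ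
  ; _≈_ = _≈_
  ; _+_ = _+_
  ; _*_ = _*_
  ; -_  = -_
  ; 0#  = 0ℝ
  ; 1#  = 1ℝ
  ; isCommutativeRing = record
    { isRing = record
      { +-isAbelianGroup = record
        { isGroup = record
          { isMonoid = record
            { isSemigroup = record
              { isMagma = record
                { isEquivalence = ≈-isEquivalence
                ; ∙-cong = λ {x} {y} {u} {v} → +-cong {x} {y} {u} {v}
                }
              ; assoc = λ x y z → pointwise {x + y + z} {x + (y + z)}
                  λ n → ℚₚ.+-assoc (seq x n) (seq y n) (seq z n)
              }
            ; identity =
                (λ x → pointwise {0ℝ + x} {x} λ n → ℚₚ.+-identityˡ (seq x n)) ,
                (λ x → pointwise {x + 0ℝ} {x} λ n → ℚₚ.+-identityʳ (seq x n))
            }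
          ; inverse =
              (λ x → pointwise { - x + x } {0ℝ} λ n → ℚₚ.+-inverseˡ (seq x n)) ,
              (λ x → pointwise {x - x} {0ℝ} λ n → ℚₚ.+-inverseʳ (seq x n))
          ; ⁻¹-cong = λ {x} {y} → -‿cong {x} {y}
          }
        ; comm = λ x y → pointwise {x + y} {y + x} λ n → ℚₚ.+-comm (seq x n) (seq y n)
        }
      ; *-cong = λ {x} {y} {u} {v} → *-cong {x} {y} {u} {v}
      ; *-assoc = λ x y z → pointwise {x * y * z} {x * (y * z)}
          λ n → ℚₚ.*-assoc (seq x n) (seq y n) (seq z n)
      ; *-identity =
          (λ x → pointwise {1ℝ * x} {x} λ n → ℚₚ.*-identityˡ (seq x n)) ,
          (λ x → pointwise {x * 1ℝ} {x} λ n → ℚₚ.*-identityʳ (seq x n))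
      ; distrib =
          (λ x y z → pointwise {x * (y + z)} {x * y + x * z}
            λ n → ℚₚ.*-distribˡ-+ (seq x n) (seq y n) (seq z n)) ,
          (λ x y z → pointwise {(y + z) * x} {y * x + z * x}
            λ n → ℚₚ.*-distribʳ-+ (seq x n) (seq y n) (seq z n))
      }
    ; *-comm = λ x y → pointwise {x * y} {y * x} λ n → ℚₚ.*-comm (seq x n) (seq y n)
    }
  }

-- A positive real is eventually bounded below by a positive rational,
-- so the value of invℚ at 0 affects only finitely many terms of the
-- reciprocal.

invℚ : ℚ → ℚ
invℚ q with q ℚₚ.≟ 0ℚ
... | yes _  = 0ℚ
... | no q≢0 = (ℚ.1/ q) {{ℚ.≢-nonZero q≢0}}

private
  invℚ-inverse : ∀ {q} → 0ℚ ℚ.< q → q ℚ.* invℚ q ≡ 1ℚ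
  invℚ-inverse {q} 0<q with q ℚₚ.≟ 0ℚ
  ... | yes q≡0 = contradiction (sym q≡0) (ℚₚ.<⇒≢ 0<q)
  ... | no q≢0  = ℚₚ.*-inverseʳ q {{ℚ.≢-nonZero q≢0}}

  -- A reciprocal u of a ≥ δ > 0 satisfies ∣u∣ ≤ d when δ d = 1.
  abs-inv : ∀ {a u δ d} → 0ℚ ℚ.< δ → δ ℚ.≤ a → a ℚ.* u ≡ 1ℚ → δ ℚ.* d ≡ 1ℚ → ℚ.∣ u ∣ ℚ.≤ d
  abs-inv {a} {u} {δ} {d} 0<δ δ≤a au δd = ℚₚ.*-cancelˡ-≤-pos δ {{ℚ.positive 0<δ}}
    (subst (δ ℚ.* ℚ.∣ u ∣ ℚ.≤_) (sym δd)
      (subst (δ ℚ.* ℚ.∣ u ∣ ℚ.≤_) a∣u∣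
        (ℚₚ.*-monoʳ-≤-nonNeg ℚ.∣ u ∣ {{ℚₚ.∣-∣-nonNeg u}} δ≤a)))
    where
    a∣u∣ : a ℚ.* ℚ.∣ u ∣ ≡ 1ℚ
    a∣u∣ = ≡.trans
      (cong (ℚ._* ℚ.∣ u ∣) (sym (ℚₚ.0≤p⇒∣p∣≡p (ℚₚ.≤-trans (ℚₚ.<⇒≤ 0<δ) δ≤a))))
      (≡.trans (sym (ℚₚ.∣p*q∣≡∣p∣*∣q∣ a u)) (cong ℚ.∣_∣ au))

  dist-inv : ∀ {a b u v d η ε} → a ℚ.* u ≡ 1ℚ → b ℚ.* v ≡ 1ℚ → 0ℚ ℚ.< d →
             ℚ.∣ u ∣ ℚ.≤ d → ℚ.∣ v ∣ ℚ.≤ d → d ℚ.* d ℚ.* η ≡ ε →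
             dist b a ℚ.< η → dist u v ℚ.< ε
  dist-inv {a} {b} {u} {v} {d} {η} {ε} au bv 0<d u≤d v≤d ddη b~a =
    subst (ℚ._< ε) (sym (≡.trans (cong ℚ.∣_∣ u-v) (ℚₚ.∣p*q∣≡∣p∣*∣q∣ (u ℚ.* v) (b ℚ.- a))))
      (ℚₚ.≤-<-trans
        (ℚₚ.*-monoʳ-≤-nonNeg (dist b a) {{ℚₚ.∣-∣-nonNeg (b ℚ.- a)}} (*-mono-≤-abs u≤d v≤d))
        (subst (d ℚ.* d ℚ.* dist b a ℚ.<_) ddη
          (ℚₚ.*-monoʳ-<-pos (d ℚ.* d) {{ℚ.positive (*-pos 0<d 0<d)}} b~a)))
    where
    u-v : u ℚ.- v ≡ u ℚ.* v ℚ.* (b ℚ.- a)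
    u-v = sym (≡.trans
      (solve 4 (λ a b u v → u :* v :* (b :- a) := u :* (b :* v) :- v :* (a :* u)) refl a b u v)
      (≡.cong₂ ℚ._-_ (≡.trans (cong (u ℚ.*_) bv) (ℚₚ.*-identityʳ u))
                     (≡.trans (cong (v ℚ.*_) au) (ℚₚ.*-identityʳ v))))

recip : (x : ℝ) → 0ℝ < x → ℝ
recip (mkℝ s cs) (δ , 0<δ , N , low) = mkℝ (λ n → invℚ (s n)) c
  where
  δ< : ∀ n → N ℕ.≤ n → δ ℚ.< s n
  δ< n N≤n = subst (ℚ._< s n) (ℚₚ.+-identityˡ δ) (low n N≤n)

  inverse : ∀ n → N ℕ.≤ n → s n ℚ.* invℚ (s n) ≡ 1ℚ
  inverse n N≤n = invℚ-inverse (ℚₚ.<-trans 0<δ (δ< n N≤n))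

  c : Cauchy (λ n → invℚ (s n))
  c ε 0<ε with solve-for 1ℚ 0<δ 0<1
  ... | d , 0<d , δd with solve-for ε (*-pos 0<d 0<d) 0<ε
  ... | η , 0<η , ddη with cs η 0<η
  ... | M , close = N ℕ.⊔ M , λ i j ≤i ≤j →
    let Ni = ℕₚ.m⊔n≤o⇒m≤o N M ≤i
        Nj = ℕₚ.m⊔n≤o⇒m≤o N M ≤j
    in dist-inv {s i} {s j} (inverse i Ni) (inverse j Nj) 0<d
      (abs-inv 0<δ (ℚₚ.<⇒≤ (δ< i Ni)) (inverse i Ni) δd)
      (abs-inv 0<δ (ℚₚ.<⇒≤ (δ< j Nj)) (inverse j Nj) δd)
      ddη
      (close j i (ℕₚ.m⊔n≤o⇒n≤o N M ≤j) (ℕₚ.m⊔n≤o⇒n≤o N M ≤i))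

*-recip : ∀ x (0<x : 0ℝ < x) → x * recip x 0<x ≈ 1ℝ
*-recip x (δ , 0<δ , N , low) ε 0<ε = N , λ n N≤n →
  subst (λ q → dist q 1ℚ ℚ.< ε)
    (sym (invℚ-inverse (ℚₚ.<-trans 0<δ (subst (ℚ._< seq x n) (ℚₚ.+-identityˡ δ) (low n N≤n)))))
    (subst (ℚ._< ε) (sym (dist-refl 1ℚ)) 0<ε)

infixl 7 _/_⟨_⟩

_/_⟨_⟩ : ℝ → (y : ℝ) → 0ℝ < y → ℝ
x / y ⟨ 0<y ⟩ = x * recip y 0<y

private
  fromℕ≥0 : ∀ n → 0ℚ ℚ.≤ + n ℚ./ 1
  fromℕ≥0 n = ℚₚ.nonNegative⁻¹ (+ n ℚ./ 1) {{ℚₚ.normalize-nonNeg n 1}}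

fromℕ>0 : ∀ n .{{_ : NonZero n}} → 0ℝ < fromℕ n
fromℕ>0 n = half q , half-pos 0<q , 0 , λ _ _ →
  subst (ℚ._< q) (sym (ℚₚ.+-identityˡ (half q)))
    (subst (half q ℚ.<_) (half+half q)
      (subst (ℚ._< half q ℚ.+ half q) (ℚₚ.+-identityʳ (half q))
        (ℚₚ.+-monoʳ-< (half q) (half-pos 0<q))))
  where
  q = + n ℚ./ 1
  0<q = ℚₚ.positive⁻¹ q {{ℚₚ.normalize-pos n 1}}

fromℕ+²>0 : ∀ n x → 0ℝ < x → 0ℝ < fromℕ n + x ²
fromℕ+²>0 n x (δ , 0<δ , N , low) = δ ℚ.* δ , *-pos 0<δ 0<δ , N , λ i N≤i →
  let δ<xi = subst (ℚ._< seq x i) (ℚₚ.+-identityˡ δ) (low i N≤i)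
      0<xi = ℚₚ.<-trans 0<δ δ<xi
  in ℚₚ.+-mono-≤-< (fromℕ≥0 n) (ℚₚ.<-trans
       (ℚₚ.*-monoʳ-<-pos δ {{ℚ.positive 0<δ}} δ<xi)
       (ℚₚ.*-monoˡ-<-pos (seq x i) {{ℚ.positive 0<xi}} δ<xi))

------------------------------------------------------------------------
-- Matrices

module Matrices {a ℓ} (R : CommutativeRing a ℓ) where

  private
    open module R = CommutativeRing R using (Carrier; 0#)
      renaming (_≈_ to _≈ᴿ_; _*_ to _*ᴿ_)

  open SemiringSum R.semiring
    using (sum; sum-cong-≋; ∑-comm; *-distribˡ-sum; *-distribʳ-sum)

  Matrix : ℕ → ℕ → Set a
  Matrix r c = Fin r → Vector Carrier c

  infix  4 _≋_
  infixl 7 _·_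
  infix  9 _ᵀ

  _≋_ : ∀ {r c} → Matrix r c → Matrix r c → Set ℓ
  A ≋ B = ∀ i j → A i j ≈ᴿ B i j

  _ᵀ : ∀ {r c} → Matrix r c → Matrix c r
  (A ᵀ) i j = A j i

  _·_ : ∀ {r s c} → Matrix r s → Matrix s c → Matrix r c
  (A · B) i j = sum λ l → A i l *ᴿ B l j

  -- The squared Frobenius norm (for real entries).
  ‖_‖F² : ∀ {r c} → Matrix r c → Carrier
  ‖ A ‖F² = sum λ i → sum λ j → A i j *ᴿ A i j

  -- The increasing enumeration of a subset.
  enum : ∀ {m} (S : Subset m) → Fin ∣ S ∣ → Fin m
  enum (true  ∷ S) zero    = zero
  enum (true  ∷ S) (suc i) = suc (enum S i)
  enum (false ∷ S) i       = suc (enum S i)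

  columns : ∀ {r m} → Matrix r m → (S : Subset m) → Matrix r ∣ S ∣
  columns X S i j = X i (enum S j)

  LinearlyIndependent : ∀ {r s} → (Fin s → Vector Carrier r) → Set (a ⊔ ℓ)
  LinearlyIndependent {s = s} v = (c : Vector Carrier s) →
    (∀ i → sum (λ j → c j *ᴿ v j i) ≈ᴿ 0#) → ∀ j → c j ≈ᴿ 0#

  -- The rank as the largest number of linearly independent columns.
  -- (Over a nontrivial ring an independent family cannot repeat a column.)
  HasRank : ∀ {n m} → Matrix n m → ℕ → Set (a ⊔ ℓ)
  HasRank {m = m} A r =
    (Σ[ f ∈ (Fin r → Fin m) ] LinearlyIndependent ((A ᵀ) ∘ f)) ×
    (∀ s (f : Fin s → Fin m) → LinearlyIndependent ((A ᵀ) ∘ f) → s ℕ.≤ r)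

  FullRank : ∀ {n m} → Matrix n m → Set (a ⊔ ℓ)
  FullRank {n} {m} A = HasRank A (n ℕ.⊓ m)

  -- The four Penrose conditions, for real entries.  They determine P
  -- (pseudoInverse-unique), so this relation expresses P = A†.
  record IsPseudoInverse {r c} (A : Matrix r c) (P : Matrix c r) : Set ℓ where
    field
      A·P·A≋A  : A · P · A ≋ A
      P·A·P≋P  : P · A · P ≋ P
      A·P-symm : (A · P) ᵀ ≋ A · P
      P·A-symm : (P · A) ᵀ ≋ P · A

  private
    ≋-sym : ∀ {r c} {A B : Matrix r c} → A ≋ B → B ≋ A
    ≋-sym p i j = R.sym (p i j)

    infixr 5 _⟫_
    _⟫_ : ∀ {r c} {A B C : Matrix r c} → A ≋ B → B ≋ C → A ≋ C
    (p ⟫ q) i j = R.trans (p i j) (q i j)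

    ·-congˡ : ∀ {r s c} (A : Matrix r s) {B B′ : Matrix s c} → B ≋ B′ → A · B ≋ A · B′
    ·-congˡ A p i j = sum-cong-≋ λ l → R.*-congˡ (p l j)

    ·-congʳ : ∀ {r s c} {A A′ : Matrix r s} (B : Matrix s c) → A ≋ A′ → A · B ≋ A′ · B
    ·-congʳ B p i j = sum-cong-≋ λ l → R.*-congʳ (p i l)

    ·-assoc : ∀ {r s t c} (A : Matrix r s) (B : Matrix s t) (C : Matrix t c) →
              A · B · C ≋ A · (B · C)
    ·-assoc A B C i j = begin
      sum (λ l → sum (λ k → A i k *ᴿ B k l) *ᴿ C l j)
        ≈⟨ sum-cong-≋ (λ l → *-distribʳ-sum (C l j) (λ k → A i k *ᴿ B k l)) ⟩
      sum (λ l → sum (λ k → A i k *ᴿ B k l *ᴿ C l j))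
        ≈⟨ ∑-comm (λ l k → A i k *ᴿ B k l *ᴿ C l j) ⟩
      sum (λ k → sum (λ l → A i k *ᴿ B k l *ᴿ C l j))
        ≈⟨ sum-cong-≋ (λ k → sum-cong-≋ (λ l → R.*-assoc (A i k) (B k l) (C l j))) ⟩
      sum (λ k → sum (λ l → A i k *ᴿ (B k l *ᴿ C l j)))
        ≈⟨ sum-cong-≋ (λ k → *-distribˡ-sum (A i k) (λ l → B k l *ᴿ C l j)) ⟨
      sum (λ k → A i k *ᴿ sum (λ l → B k l *ᴿ C l j)) ∎
      where open import Relation.Binary.Reasoning.Setoid R.setoid

    ·-ᵀ : ∀ {r s c} (A : Matrix r s) (B : Matrix s c) → (A · B) ᵀ ≋ (B ᵀ) · (A ᵀ)
    ·-ᵀ A B i j = sum-cong-≋ λ l → R.*-comm (A j l) (B l i)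

    symm-swap : ∀ {r} (E F G : Matrix r r) → E ᵀ ≋ E → F ᵀ ≋ F → G ᵀ ≋ G →
                E · F ≋ G → G ≋ F · E
    symm-swap E F G Eᵀ Fᵀ Gᵀ EF =
      ≋-sym Gᵀ ⟫ (λ i j → ≋-sym EF j i) ⟫ ·-ᵀ E F ⟫ ·-congʳ (E ᵀ) Fᵀ ⟫ ·-congˡ F Eᵀ

  pseudoInverse-unique : ∀ {r c} {A : Matrix r c} {P Q} →
    IsPseudoInverse A P → IsPseudoInverse A Q → P ≋ Q
  pseudoInverse-unique {A = A} {P} {Q} p q =
    ≋-sym p.P·A·P≋P ⟫ ·-congʳ P PA≋QA ⟫ ·-assoc Q A P ⟫ ·-congˡ Q AP≋AQ ⟫
    ≋-sym (·-assoc Q A Q) ⟫ q.P·A·P≋P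
    where
    module p = IsPseudoInverse p
    module q = IsPseudoInverse q

    AP≋AQ : A · P ≋ A · Q
    AP≋AQ = symm-swap (A · Q) (A · P) (A · P) q.A·P-symm p.A·P-symm p.A·P-symm
        (≋-sym (·-assoc (A · Q) A P) ⟫ ·-congʳ P q.A·P·A≋A)
      ⟫ ≋-sym (·-assoc (A · P) A Q) ⟫ ·-congʳ Q p.A·P·A≋A

    PA≋QA : P · A ≋ Q · A
    PA≋QA = symm-swap (P · A) (Q · A) (P · A) p.P·A-symm q.P·A-symm p.P·A-symm
        (·-assoc P A (Q · A) ⟫ ·-congˡ P (≋-sym (·-assoc A Q A) ⟫ q.A·P·A≋A))
      ⟫ ·-assoc Q A (P · A) ⟫ ·-congˡ Q (≋-sym (·-assoc A P A) ⟫ p.A·P·A≋A)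

open Matrices ℝ-commutativeRing public

module Submission where

-- Take X = [I I … I], with m/n blocks.  If s_i columns of X_S equal e_i, then X_S X_Sᵀ is
-- diagonal with entries s_i summing to k, so ‖X_S†‖² = Σ 1/s_i ≥ n²/k, while
-- ‖X†‖² = n²/m.  The ratio is at least m/k = (m - k)/k + 1, which exceeds the coefficient
-- of the theorem.

open import Algebra.Bundles using (CommutativeRing)
import Algebra.Properties.CommutativeSemigroup as CommutativeSemigroupProperties
import Algebra.Properties.Ring as RingProperties
import Algebra.Properties.Semiring.Sum as SemiringSum
open import Data.Bool.Base using (if_then_else_)
open import Data.Fin.Base using (Fin; zero; suc; combine; remQuot; punchOut; _↑ˡ_; _↑ʳ_)
import Data.Fin.Properties as Fin
open import Data.Fin.Subset using (Subset; ∣_∣)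
open import Data.Integer.Base as ℤ using (+_; +≤+)
import Data.Integer.Properties as ℤ
open import Data.Nat as ℕ using (ℕ; zero; suc; NonZero)
import Data.Nat.Coprimality as Coprimality
open import Data.Nat.Divisibility using (_∣_; divides)
import Data.Nat.Properties as ℕ
open import Data.Product using (Σ-syntax; ∃; _×_; _,_; proj₁; proj₂)
open import Data.Rational.Base as ℚ using (ℚ; 0ℚ; 1ℚ)
import Data.Rational.Properties as ℚ
import Data.Rational.Solver as ℚSolver
open import Data.Sum.Base using (_⊎_; inj₁; inj₂)
open import Data.Vec.Functional using (Vector)
import Defs
open import Function.Base using (_∘_; id; case_of_)
open import Function.Definitions using (Injective)
open import Relation.Binary.PropositionalEquality as ≡ using (_≡_; _≢_; cong; cong₂; subst)
open import Relation.Nullary using (¬_; yes; no; does; contradiction)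

-- If `f` missed `i`, punching `i` out of the codomain would inject a set of `suc n` elements into
-- one of `n`.
injective⇒preimage : ∀ {n} {f : Fin n → Fin n} → Injective _≡_ _≡_ f → ∀ i → ∃ λ j → f j ≡ i
injective⇒preimage {suc n} {f} inj i with Fin.any? (λ j → f j Fin.≟ i)
... | yes hit = hit
... | no miss = contradiction (Fin.injective⇒≤ {f = λ j → punchOut (i≢f j)} λ {a} {b} eq →
        inj (Fin.punchOut-injective (i≢f a) (i≢f b) eq)) ℕ.1+n≰n
  where
  i≢f : ∀ j → i ≢ f j
  i≢f j i≡fj = miss (j , ≡.sym i≡fj)

-- Incidence matrices of maps between finite sets, over a commutative ring

module Incidence {a ℓ} (R : CommutativeRing a ℓ) where

  open CommutativeRing R hiding (zero)
  open RingProperties ring using (-‿distribˡ-*; -‿distribʳ-*; -0#≈0#)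
  open CommutativeSemigroupProperties *-commutativeSemigroup using (interchange; xy∙z≈zy∙x)
  open SemiringSum semiring
  private
    module M = Defs.Matrices R
  open import Relation.Binary.Reasoning.Setoid setoid

  sum-zero : ∀ {n} {f : Vector Carrier n} → (∀ i → f i ≈ 0#) → sum f ≈ 0#
  sum-zero {n} f≈0 = trans (sum-cong-≋ f≈0) (sum-replicate-zero n)

  sum-single : ∀ {n} (f : Vector Carrier n) i → (∀ j → j ≢ i → f j ≈ 0#) → sum f ≈ f i
  sum-single f zero    f≈0 = trans (+-congˡ (sum-zero λ j → f≈0 (suc j) λ ())) (+-identityʳ _)
  sum-single f (suc i) f≈0 = begin
    f zero + sum (f ∘ suc)  ≈⟨ +-cong (f≈0 zero λ ()) (sum-single (f ∘ suc) i λ j j≢i → f≈0 (suc j) (j≢i ∘ Fin.suc-injective)) ⟩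
    0# + f (suc i)          ≈⟨ +-identityˡ _ ⟩
    f (suc i)               ∎

  sum-++ : ∀ p {q} (f : Vector Carrier (p ℕ.+ q)) →
           sum f ≈ sum (λ i → f (i ↑ˡ q)) + sum (λ i → f (p ↑ʳ i))
  sum-++ zero    f = sym (+-identityˡ _)
  sum-++ (suc p) f = trans (+-congˡ (sum-++ p (f ∘ suc))) (sym (+-assoc _ _ _))

  sum-combine : ∀ l {n} (f : Vector Carrier (l ℕ.* n)) →
                sum f ≈ sum {l} (λ a → sum {n} λ b → f (combine a b))
  sum-combine zero        f = refl
  sum-combine (suc l) {n} f = trans (sum-++ n f) (+-congˡ (sum-combine l (f ∘ (n ↑ʳ_))))

  sum-ones-* : ∀ {n} x → sum {n} (λ _ → 1#) * x ≈ sum {n} (λ _ → x)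
  sum-ones-* {n} x = trans (*-distribʳ-sum {n} x (λ _ → 1#)) (sum-cong-≋ {n} λ _ → *-identityˡ x)

  -- Column `j` is the standard basis vector at `r j`; for `r = id` this is the identity matrix.
  incidence : ∀ {n c} → (Fin c → Fin n) → M.Matrix n c
  incidence r i j = if does (r j Fin.≟ i) then 1# else 0#

  -- A property up to `≈` instead of one fixed matrix, so that column submatrices and entrywise
  -- embeddings of rational matrices into the reals qualify as well.
  record IsIncidence {n c} (A : M.Matrix n c) (r : Fin c → Fin n) : Set ℓ where
    field
      on  : ∀ {i j} → r j ≡ i → A i j ≈ 1#
      off : ∀ {i j} → r j ≢ i → A i j ≈ 0#

  incidence-isIncidence : ∀ {n c} (r : Fin c → Fin n) → IsIncidence (incidence r) r
  incidence-isIncidence r = record { on = on ; off = off }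
    where
    on : ∀ {i j} → r j ≡ i → incidence r i j ≈ 1#
    on {i} {j} eq with r j Fin.≟ i
    ... | yes _ = refl
    ... | no ne = contradiction eq ne
    off : ∀ {i j} → r j ≢ i → incidence r i j ≈ 0#
    off {i} {j} ne with r j Fin.≟ i
    ... | yes eq = contradiction eq ne
    ... | no _   = refl

  difference : ∀ {s} → Fin s → Fin s → Vector Carrier s
  difference a b j = incidence id a j + - incidence id b j

  difference-on : ∀ {s} {a b : Fin s} → a ≢ b → difference a b a ≈ 1#
  difference-on {s} {a} {b} a≢b =
    trans (+-cong (e.on {a} {a} ≡.refl) (trans (-‿cong (e.off a≢b)) -0#≈0#)) (+-identityʳ _)
    where module e = IsIncidence (incidence-isIncidence {s} id)

  columns-isIncidence : ∀ {n c} {A : M.Matrix n c} {r : Fin c → Fin n} → IsIncidence A r →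
                        ∀ S → IsIncidence (M.columns A S) (r ∘ M.enum S)
  columns-isIncidence isIncidence S = record { on = on ; off = off }
    where open IsIncidence isIncidence

  -- This is `Aᵀ` times the diagonal matrix of `w`. For an incidence matrix `A Aᵀ` is the diagonal
  -- matrix of row sums, so with `w` their reciprocals it is the right inverse `Aᵀ (A Aᵀ)⁻¹`.
  weightedTranspose : ∀ {n c} → M.Matrix n c → Vector Carrier n → M.Matrix c n
  weightedTranspose A w j i = A i j * w i

  module _ {n c} {A : M.Matrix n c} {r : Fin c → Fin n} (isIncidence : IsIncidence A r) where

    open IsIncidence isIncidence

    columnSum : ∀ j → sum (λ i → A i j) ≈ 1#
    columnSum j = trans (sum-single _ (r j) λ i i≢rj → off (i≢rj ∘ ≡.sym)) (on ≡.refl)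

    entrySum : sum (λ i → sum (A i)) ≈ sum {c} (λ _ → 1#)
    entrySum = trans (∑-comm A) (sum-cong-≋ columnSum)

    entry-idem : ∀ i j → A i j * A i j ≈ A i j
    entry-idem i j with r j Fin.≟ i
    ... | yes eq = trans (*-congʳ (on eq)) (*-identityˡ _)
    ... | no ne  = trans (*-congʳ (off ne)) (trans (zeroˡ _) (sym (off ne)))

    rows-orthogonal : ∀ {i i′} → i ≢ i′ → ∀ j → A i j * A i′ j ≈ 0#
    rows-orthogonal {i} i≢i′ j with r j Fin.≟ i
    ... | yes ≡.refl = trans (*-congˡ (off i≢i′)) (zeroʳ _)
    ... | no ne      = trans (*-congʳ (off ne)) (zeroˡ _)

    -- In row `r (f j)` only the `j`-th chosen column has a nonzero entry, so that row of the
    -- relation isolates `x j`.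
    injective⇒independent : ∀ {s} (f : Fin s → Fin c) → Injective _≡_ _≡_ (r ∘ f) →
                          M.LinearlyIndependent ((A M.ᵀ) ∘ f)
    injective⇒independent f inj x x·A≈0 j = begin
      x j                                         ≈⟨ *-identityʳ _ ⟨
      x j * 1#                                    ≈⟨ *-congˡ (on ≡.refl) ⟨
      x j * A (r (f j)) (f j)                     ≈⟨ sum-single _ j (λ j′ j′≢j → trans (*-congˡ (off (j′≢j ∘ inj))) (zeroʳ _)) ⟨
      sum (λ j′ → x j′ * A (r (f j)) (f j′))      ≈⟨ x·A≈0 (r (f j)) ⟩
      0#                                          ∎

    column-cong : ∀ {j j′} → r j ≡ r j′ → ∀ i → A i j ≈ A i j′
    column-cong {j} eq i with r j Fin.≟ i
    ... | yes rj≡i = trans (on rj≡i) (sym (on (≡.trans (≡.sym eq) rj≡i)))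
    ... | no rj≢i  = trans (off rj≢i) (sym (off (rj≢i ∘ ≡.trans eq)))

    equal-columns⇒relation : ∀ {s} (f : Fin s → Fin c) {a b} → r (f a) ≡ r (f b) →
                             ∀ i → sum (λ j → difference a b j * A i (f j)) ≈ 0#
    equal-columns⇒relation {s} f {a} {b} eq i = begin
      sum (λ j → difference a b j * y j)
        ≈⟨ sum-cong-≋ {s} (λ j → trans (distribʳ (y j) (e a j) (- e b j)) (+-congˡ (trans (sym (-‿distribˡ-* _ _)) (-‿distribʳ-* (e b j) (y j))))) ⟩
      sum (λ j → e a j * y j + e b j * - y j)
        ≈⟨ ∑-distrib-+ (λ j → e a j * y j) (λ j → e b j * - y j) ⟩
      sum (λ j → e a j * y j) + sum (λ j → e b j * - y j)
        ≈⟨ +-cong (pick a y) (pick b (λ j → - y j)) ⟩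
      y a - y b
        ≈⟨ +-congˡ (-‿cong (column-cong (≡.sym eq) i)) ⟩
      y a - y a
        ≈⟨ -‿inverseʳ _ ⟩
      0# ∎
      where
      e : Fin s → Vector Carrier s
      e = incidence id
      module e = IsIncidence (incidence-isIncidence {s} id)

      y : Vector Carrier s
      y j = A i (f j)

      pick : ∀ k (z : Vector Carrier s) → sum (λ j → e k j * z j) ≈ z k
      pick k z = trans (sum-single _ k λ j j≢k → trans (*-congʳ (e.off j≢k)) (zeroˡ _))
                       (trans (*-congʳ (e.on {k} {k} ≡.refl)) (*-identityˡ _))

    -- Two chosen columns with the same label are equal, so `difference a b` is a relation between
    -- them, and its coefficient at `a` is 1.
    independent⇒injective : ¬ 1# ≈ 0# → ∀ {s} (f : Fin s → Fin c) →
                            M.LinearlyIndependent ((A M.ᵀ) ∘ f) → Injective _≡_ _≡_ (r ∘ f)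
    independent⇒injective 1≉0 f independent {a} {b} eq with a Fin.≟ b
    ... | yes a≡b = a≡b
    ... | no a≢b  = contradiction
      (trans (sym (difference-on a≢b)) (independent (difference a b) (equal-columns⇒relation f eq) a)) 1≉0

    -- A section selects one column for each basis vector. Conversely the labels of any independent
    -- family are distinct elements of `Fin n`, which bounds its size by `n`.
    section⇒hasRank : ¬ 1# ≈ 0# → (f : Fin n → Fin c) → (∀ i → r (f i) ≡ i) → M.HasRank A n
    section⇒hasRank 1≉0 f r∘f≡id =
      (f , injective⇒independent f λ eq → ≡.trans (≡.sym (r∘f≡id _)) (≡.trans eq (r∘f≡id _))) ,
      λ s g independent → Fin.injective⇒≤ (independent⇒injective 1≉0 g independent)

    module _ {w : Vector Carrier n} (weight : ∀ i → sum (A i) * w i ≈ 1#) where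

      private
        P : M.Matrix c n
        P = weightedTranspose A w

        AP-diag : ∀ i → (A M.· P) i i ≈ 1#
        AP-diag i = begin
          sum (λ j → A i j * (A i j * w i))  ≈⟨ sum-cong-≋ {c} (λ j → trans (sym (*-assoc _ _ _)) (*-congʳ (entry-idem i j))) ⟩
          sum (λ j → A i j * w i)            ≈⟨ *-distribʳ-sum (w i) (A i) ⟨
          sum (A i) * w i                    ≈⟨ weight i ⟩
          1#                                 ∎

        AP-off : ∀ {i i′} → i ≢ i′ → (A M.· P) i i′ ≈ 0#
        AP-off i≢i′ = sum-zero {c} λ j →
          trans (sym (*-assoc _ _ _)) (trans (*-congʳ (rows-orthogonal i≢i′ j)) (zeroˡ _))

        PA : ∀ j j′ → (P M.· A) j j′ ≈ w (r j) * A (r j) j′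
        PA j j′ = begin
          sum (λ i → A i j * w i * A i j′)  ≈⟨ sum-single _ (r j) (λ i i≢rj → trans (*-congʳ (trans (*-congʳ (off (i≢rj ∘ ≡.sym))) (zeroˡ _))) (zeroˡ _)) ⟩
          A (r j) j * w (r j) * A (r j) j′  ≈⟨ *-congʳ (trans (*-congʳ (on ≡.refl)) (*-identityˡ _)) ⟩
          w (r j) * A (r j) j′              ∎

        PAP : ∀ j i → (P M.· A M.· P) j i ≈ w (r j) * (A M.· P) (r j) i
        PAP j i = begin
          sum (λ j′ → (P M.· A) j j′ * P j′ i)          ≈⟨ sum-cong-≋ {c} (λ j′ → trans (*-congʳ (PA j j′)) (*-assoc _ _ _)) ⟩
          sum (λ j′ → w (r j) * (A (r j) j′ * P j′ i))  ≈⟨ *-distribˡ-sum (w (r j)) (λ j′ → A (r j) j′ * P j′ i) ⟨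
          w (r j) * (A M.· P) (r j) i                   ∎

      -- `A P` is the identity by `AP-diag` and `AP-off`, which settles the first three conditions.
      -- The entries of `P A` are sums of `A i j * w i * A i j′`, symmetric in `j` and `j′`.
      weightedTranspose-isPseudoInverse : M.IsPseudoInverse A P
      weightedTranspose-isPseudoInverse = record
        { A·P·A≋A  = λ i j → trans
            (sum-single _ i λ i′ i′≢i → trans (*-congʳ (AP-off (i′≢i ∘ ≡.sym))) (zeroˡ _))
            (trans (*-congʳ (AP-diag i)) (*-identityˡ _))
        ; P·A·P≋P  = λ j i → trans (PAP j i) (case r j Fin.≟ i of λ
            { (yes ≡.refl) → *-cong-swap (AP-diag _) (on ≡.refl)
            ; (no ne)      → trans (trans (*-congˡ (AP-off ne)) (zeroʳ _))
                                   (sym (trans (*-congʳ (off ne)) (zeroˡ _)))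
            })
        ; A·P-symm = λ i i′ → case i Fin.≟ i′ of λ
            { (yes ≡.refl) → refl
            ; (no ne)      → trans (AP-off (ne ∘ ≡.sym)) (sym (AP-off ne))
            }
        ; P·A-symm = λ j j′ → sum-cong-≋ {n} λ i → xy∙z≈zy∙x _ _ _
        }
        where
        *-cong-swap : ∀ {x y z} → y ≈ 1# → z ≈ 1# → x * y ≈ z * x
        *-cong-swap y≈1 z≈1 = trans (*-comm _ _) (*-congʳ (trans y≈1 (sym z≈1)))

      -- Since the entries of `A` are idempotent, index `i` contributes its row sum times
      -- `w i * w i`, which is `w i`.
      ‖weightedTranspose‖F² : M.‖ P ‖F² ≈ sum w
      ‖weightedTranspose‖F² = begin
        sum (λ j → sum λ i → A i j * w i * (A i j * w i))
          ≈⟨ ∑-comm (λ j i → A i j * w i * (A i j * w i)) ⟩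
        sum (λ i → sum λ j → A i j * w i * (A i j * w i))
          ≈⟨ sum-cong-≋ row ⟩
        sum w ∎
        where
        row : ∀ i → sum (λ j → A i j * w i * (A i j * w i)) ≈ w i
        row i = begin
          sum (λ j → A i j * w i * (A i j * w i))  ≈⟨ sum-cong-≋ {c} (λ j → trans (interchange _ _ _ _) (*-congʳ (entry-idem i j))) ⟩
          sum (λ j → A i j * (w i * w i))          ≈⟨ *-distribʳ-sum (w i * w i) (A i) ⟨
          sum (A i) * (w i * w i)                  ≈⟨ *-assoc _ _ _ ⟨
          sum (A i) * w i * w i                    ≈⟨ *-congʳ (weight i) ⟩
          1# * w i                                 ≈⟨ *-identityˡ _ ⟩
          w i                                      ∎

  -- Each of the `l` blocks is an identity matrix and puts exactly one 1 into row `i`.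
  rowSum-remainder : ∀ l {n} {A : M.Matrix n (l ℕ.* n)} →
    IsIncidence A (proj₂ ∘ remQuot {l} n) → ∀ i → sum (A i) ≈ sum {l} (λ _ → 1#)
  rowSum-remainder l {n} {A} isIncidence i = trans (sum-combine l (A i)) (sum-cong-≋ {l} λ a →
    trans (sum-single {n} _ i λ b b≢i → off (b≢i ∘ ≡.trans (≡.sym (remainder a b))))
          (on (remainder a i)))
    where
    open IsIncidence isIncidence
    remainder : ∀ a b → proj₂ (remQuot {l} n (combine a b)) ≡ b
    remainder a b = cong proj₂ (Fin.remQuot-combine a b)

open Defs

-- Order and finite sums over the rationals

module ℚRing = CommutativeRing ℚ.+-*-commutativeRing
module ℝRing = CommutativeRing ℝ-commutativeRing
module Σℚ = SemiringSum ℚRing.semiring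
module Σℝ = SemiringSum ℝRing.semiring
module Incℚ = Incidence ℚ.+-*-commutativeRing
module Incℝ = Incidence ℝ-commutativeRing
module Matℚ = Matrices ℚ.+-*-commutativeRing

0≤* : ∀ {p q} → 0ℚ ℚ.≤ p → 0ℚ ℚ.≤ q → 0ℚ ℚ.≤ p ℚ.* q
0≤* {p} {q} 0≤p 0≤q = ℚ.nonNegative⁻¹ (p ℚ.* q)
  {{ℚ.nonNeg*nonNeg⇒nonNeg p {{ℚ.nonNegative 0≤p}} q {{ℚ.nonNegative 0≤q}}}}

0≤p*p : ∀ p → 0ℚ ℚ.≤ p ℚ.* p
0≤p*p p = subst (0ℚ ℚ.≤_)
  (≡.trans (≡.sym (ℚ.∣p*q∣≡∣p∣*∣q∣ p p)) (abs-square (ℚ.≤-total 0ℚ p)))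
  (0≤* (ℚ.0≤∣p∣ p) (ℚ.0≤∣p∣ p))
  where
  abs-square : 0ℚ ℚ.≤ p ⊎ p ℚ.≤ 0ℚ → ℚ.∣ p ℚ.* p ∣ ≡ p ℚ.* p
  abs-square (inj₁ 0≤p) = ℚ.0≤p⇒∣p∣≡p (0≤* 0≤p 0≤p)
  abs-square (inj₂ p≤0) = ℚ.0≤p⇒∣p∣≡p (subst (0ℚ ℚ.≤_) -p*-p (0≤* 0≤-p 0≤-p))
    where
    open ℚSolver.+-*-Solver
    0≤-p : 0ℚ ℚ.≤ ℚ.- p
    0≤-p = ℚ.neg-antimono-≤ p≤0
    -p*-p : ℚ.- p ℚ.* ℚ.- p ≡ p ℚ.* p
    -p*-p = solve 1 (λ p → (:- p) :* (:- p) := p :* p) ≡.refl p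

p≤p+q : ∀ p {q} → 0ℚ ℚ.≤ q → p ℚ.≤ p ℚ.+ q
p≤p+q p {q} 0≤q = subst (ℚ._≤ p ℚ.+ q) (ℚ.+-identityʳ p) (ℚ.+-monoʳ-≤ p 0≤q)

0≤q-p⇒p≤q : ∀ {p q} → 0ℚ ℚ.≤ q ℚ.- p → p ℚ.≤ q
0≤q-p⇒p≤q {p} {q} 0≤q-p = subst (p ℚ.≤_) (solve 2 (λ p q → p :+ (q :- p) := q) ≡.refl p q) (p≤p+q p 0≤q-p)
  where open ℚSolver.+-*-Solver

p≤q⇒0≤q-p : ∀ {p q} → p ℚ.≤ q → 0ℚ ℚ.≤ q ℚ.- p
p≤q⇒0≤q-p {p} {q} p≤q = subst (ℚ._≤ q ℚ.- p) (ℚ.+-inverseʳ p) (ℚ.+-monoˡ-≤ (ℚ.- p) p≤q)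

invℚ-inverse : ∀ {q} → 0ℚ ℚ.< q → q ℚ.* invℚ q ≡ 1ℚ
invℚ-inverse {q} 0<q with q ℚ.≟ 0ℚ
... | yes q≡0 = contradiction (≡.sym q≡0) (ℚ.<⇒≢ 0<q)
... | no q≢0  = ℚ.*-inverseʳ q {{ℚ.≢-nonZero q≢0}}

-- A right inverse x of p is p x².
inverse-nonNeg : ∀ {p x} → 0ℚ ℚ.≤ p → p ℚ.* x ≡ 1ℚ → 0ℚ ℚ.≤ x
inverse-nonNeg {p} {x} 0≤p px = subst (0ℚ ℚ.≤_)
  (≡.trans (≡.sym (ℚ.*-assoc p x x)) (≡.trans (cong (ℚ._* x) px) (ℚ.*-identityˡ x)))
  (0≤* 0≤p (0≤p*p x))

sum-mono : ∀ {n} {f g : Vector ℚ n} → (∀ i → f i ℚ.≤ g i) → Σℚ.sum f ℚ.≤ Σℚ.sum g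
sum-mono {zero}  f≤g = ℚ.≤-refl
sum-mono {suc n} f≤g = ℚ.+-mono-≤ (f≤g zero) (sum-mono (f≤g ∘ suc))

sum-nonNeg : ∀ {n} {f : Vector ℚ n} → (∀ i → 0ℚ ℚ.≤ f i) → 0ℚ ℚ.≤ Σℚ.sum f
sum-nonNeg {zero}  0≤f = ℚ.≤-refl
sum-nonNeg {suc n} 0≤f = ℚ.+-mono-≤ (0≤f zero) (sum-nonNeg (0≤f ∘ suc))

term≤sum : ∀ {n} {f : Vector ℚ n} → (∀ i → 0ℚ ℚ.≤ f i) → ∀ i → f i ℚ.≤ Σℚ.sum f
term≤sum {f = f} 0≤f zero    = p≤p+q (f zero) (sum-nonNeg (0≤f ∘ suc))
term≤sum {f = f} 0≤f (suc i) = subst (ℚ._≤ Σℚ.sum f) (ℚ.+-identityˡ (f (suc i)))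
  (ℚ.+-mono-≤ (0≤f zero) (term≤sum (0≤f ∘ suc) i))

-- With numerator and denominator explicit instead of gcd-normalised, sums and comparisons reduce to
-- integer arithmetic.
n/1≡mkℚ : ∀ n → + n ℚ./ 1 ≡ ℚ.mkℚ (+ n) 0 (Coprimality.sym (Coprimality.1-coprimeTo n))
n/1≡mkℚ n = ℚ.normalize-coprime (Coprimality.sym (Coprimality.1-coprimeTo n))

sum-ones : ∀ n → Σℚ.sum {n} (λ _ → 1ℚ) ≡ + n ℚ./ 1
sum-ones zero    = ≡.refl
sum-ones (suc n) = begin
  1ℚ ℚ.+ Σℚ.sum {n} (λ _ → 1ℚ)           ≡⟨ cong (1ℚ ℚ.+_) (≡.trans (sum-ones n) (n/1≡mkℚ n)) ⟩
  (+ 1 ℤ.+ + n ℤ.* + 1) ℚ./ 1            ≡⟨ cong (λ z → (+ 1 ℤ.+ z) ℚ./ 1) (ℤ.*-identityʳ (+ n)) ⟩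
  + suc n ℚ./ 1                          ∎
  where
  open ≡.≡-Reasoning

/1-mono-≤ : ∀ {m n} → m ℕ.≤ n → + m ℚ./ 1 ℚ.≤ + n ℚ./ 1
/1-mono-≤ {m} {n} m≤n = ≡.subst₂ ℚ._≤_ (≡.sym (n/1≡mkℚ m)) (≡.sym (n/1≡mkℚ n))
  (ℚ.*≤* (ℤ.*-monoʳ-≤-nonNeg (+ 1) (+≤+ m≤n)))

/1-pos : ∀ n .{{_ : NonZero n}} → 0ℚ ℚ.< + n ℚ./ 1
/1-pos n = ℚ.positive⁻¹ (+ n ℚ./ 1) {{ℚ.normalize-pos n 1}}

-- The mean inequality and the rational form of the bound

-- The tangent-line form of the inequality between harmonic and arithmetic means:
-- w - (2t - t²s) = s (w - t)² when s w = 1.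
reciprocal-tangent : ∀ {s w} t → 0ℚ ℚ.≤ s → s ℚ.* w ≡ 1ℚ → (t ℚ.+ t) ℚ.- t ℚ.* t ℚ.* s ℚ.≤ w
reciprocal-tangent {s} {w} t 0≤s sw = 0≤q-p⇒p≤q
  (subst (0ℚ ℚ.≤_) identity (0≤* 0≤s (0≤p*p (w ℚ.- t))))
  where
  open ℚSolver.+-*-Solver
  identity : s ℚ.* ((w ℚ.- t) ℚ.* (w ℚ.- t)) ≡ w ℚ.- ((t ℚ.+ t) ℚ.- t ℚ.* t ℚ.* s)
  identity = ≡.trans
    (solve 3 (λ s w t → s :* ((w :- t) :* (w :- t)) := (s :* w) :* w :- ((s :* w) :* (t :+ t) :- t :* t :* s)) ≡.refl s w t)
    (cong₂ (λ p q → p ℚ.- (q ℚ.- t ℚ.* t ℚ.* s))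
      (≡.trans (cong (ℚ._* w) sw) (ℚ.*-identityˡ w))
      (≡.trans (cong (ℚ._* (t ℚ.+ t)) sw) (ℚ.*-identityˡ (t ℚ.+ t))))

-- The tangent bounds are added at one common point `t`. The best choice, `n` divided by the sum of
-- `s`, turns the left side into `n²` over that sum.
sum-reciprocals-tangent : ∀ {n} {s w : Vector ℚ n} t →
  (∀ i → 0ℚ ℚ.≤ s i) → (∀ i → s i ℚ.* w i ≡ 1ℚ) →
  + n ℚ./ 1 ℚ.* (t ℚ.+ t) ℚ.- t ℚ.* t ℚ.* Σℚ.sum s ℚ.≤ Σℚ.sum w
sum-reciprocals-tangent {n} {s} {w} t 0≤s sw =
  subst (ℚ._≤ Σℚ.sum w) sum-tangent (sum-mono λ i → reciprocal-tangent t (0≤s i) (sw i))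
  where
  open ≡.≡-Reasoning
  sum-tangent : Σℚ.sum (λ i → (t ℚ.+ t) ℚ.- t ℚ.* t ℚ.* s i) ≡ + n ℚ./ 1 ℚ.* (t ℚ.+ t) ℚ.- t ℚ.* t ℚ.* Σℚ.sum s
  sum-tangent = begin
    Σℚ.sum (λ i → (t ℚ.+ t) ℚ.- t ℚ.* t ℚ.* s i)
      ≡⟨ Σℚ.sum-cong-≋ {n} (λ i → cong ((t ℚ.+ t) ℚ.+_) (ℚ.neg-distribˡ-* (t ℚ.* t) (s i))) ⟩
    Σℚ.sum (λ i → (t ℚ.+ t) ℚ.+ ℚ.- (t ℚ.* t) ℚ.* s i)
      ≡⟨ Σℚ.∑-distrib-+ {n} (λ _ → t ℚ.+ t) (λ i → ℚ.- (t ℚ.* t) ℚ.* s i) ⟩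
    Σℚ.sum {n} (λ _ → t ℚ.+ t) ℚ.+ Σℚ.sum (λ i → ℚ.- (t ℚ.* t) ℚ.* s i)
      ≡⟨ cong₂ ℚ._+_ (≡.trans (≡.sym (Incℚ.sum-ones-* {n} (t ℚ.+ t))) (cong (ℚ._* (t ℚ.+ t)) (sum-ones n)))
                     (≡.trans (≡.sym (Σℚ.*-distribˡ-sum (ℚ.- (t ℚ.* t)) s)) (≡.sym (ℚ.neg-distribˡ-* (t ℚ.* t) (Σℚ.sum s)))) ⟩
    + n ℚ./ 1 ℚ.* (t ℚ.+ t) ℚ.- t ℚ.* t ℚ.* Σℚ.sum s ∎

-- Both sides are compared with N²/K: the coefficient is at most (M - K)/K + 1 = M/K,
-- and M/K · N u = N²/K because N L = M and L u = 1.
coefficient-bound : ∀ {N K M L u a d μ ι W} →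
  0ℚ ℚ.≤ N → 0ℚ ℚ.≤ K → K ℚ.≤ M → 0ℚ ℚ.≤ L →
  K ℚ.* ι ≡ 1ℚ → N ℚ.* μ ≡ 1ℚ → (K ℚ.+ a ℚ.* a) ℚ.* d ≡ 1ℚ →
  N ℚ.* L ≡ M → L ℚ.* u ≡ 1ℚ →
  N ℚ.* (N ℚ.* ι ℚ.+ N ℚ.* ι) ℚ.- N ℚ.* ι ℚ.* (N ℚ.* ι) ℚ.* K ℚ.≤ W →
  ((M ℚ.- K) ℚ.* d ℚ.+ 1ℚ ℚ.- K ℚ.* μ) ℚ.* (N ℚ.* u) ℚ.≤ W
coefficient-bound {N} {K} {M} {L} {u} {a} {d} {μ} {ι} {W} 0≤N 0≤K K≤M 0≤L Kι Nμ Dd NL Lu tangent≤W = begin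
  ((M ℚ.- K) ℚ.* d ℚ.+ 1ℚ ℚ.- K ℚ.* μ) ℚ.* (N ℚ.* u)
    ≤⟨ ℚ.*-monoʳ-≤-nonNeg (N ℚ.* u) {{ℚ.nonNegative (0≤* 0≤N 0≤u)}} coefficient≤Mι ⟩
  M ℚ.* ι ℚ.* (N ℚ.* u)
    ≡⟨ cong (λ m → m ℚ.* ι ℚ.* (N ℚ.* u)) (≡.sym NL) ⟩
  N ℚ.* L ℚ.* ι ℚ.* (N ℚ.* u)
    ≡⟨ solve 4 (λ N L ι u → N :* L :* ι :* (N :* u) := N :* N :* ι :* (L :* u)) ≡.refl N L ι u ⟩
  N ℚ.* N ℚ.* ι ℚ.* (L ℚ.* u)
    -- Both `L u` and `2 - K ι` equal 1; the second form unfolds to the tangent bound at `t = N ι`.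
    ≡⟨ cong (N ℚ.* N ℚ.* ι ℚ.*_) (≡.trans Lu (≡.sym (2-x≡1 Kι))) ⟩
  N ℚ.* N ℚ.* ι ℚ.* ((1ℚ ℚ.+ 1ℚ) ℚ.- K ℚ.* ι)
    ≡⟨ solve 3 (λ N K ι → N :* N :* ι :* ((con 1ℚ :+ con 1ℚ) :- K :* ι) := N :* (N :* ι :+ N :* ι) :- N :* ι :* (N :* ι) :* K) ≡.refl N K ι ⟩
  N ℚ.* (N ℚ.* ι ℚ.+ N ℚ.* ι) ℚ.- N ℚ.* ι ℚ.* (N ℚ.* ι) ℚ.* K
    ≤⟨ tangent≤W ⟩
  W ∎
  where
  open ℚ.≤-Reasoning
  open ℚSolver.+-*-Solver

  2-x≡1 : ∀ {x} → x ≡ 1ℚ → (1ℚ ℚ.+ 1ℚ) ℚ.- x ≡ 1ℚ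
  2-x≡1 ≡.refl = ≡.refl

  0≤u : 0ℚ ℚ.≤ u
  0≤u = inverse-nonNeg 0≤L Lu
  0≤ι : 0ℚ ℚ.≤ ι
  0≤ι = inverse-nonNeg 0≤K Kι
  0≤μ : 0ℚ ℚ.≤ μ
  0≤μ = inverse-nonNeg 0≤N Nμ
  0≤d : 0ℚ ℚ.≤ d
  0≤d = inverse-nonNeg (ℚ.+-mono-≤ 0≤K (0≤p*p a)) Dd

  -- Multiplying `(K + a²) d = 1` by `ι` and using `K ι = 1` writes `ι - d` as a product of
  -- nonnegative factors, which gives `1/(K + a²) ≤ 1/K`.
  ι-d : a ℚ.* a ℚ.* d ℚ.* ι ≡ ι ℚ.- d
  ι-d = begin-equality
    a ℚ.* a ℚ.* d ℚ.* ι
      ≡⟨ solve 4 (λ K a d ι → a :* a :* d :* ι := (K :+ a :* a) :* d :* ι :- (K :* ι) :* d) ≡.refl K a d ι ⟩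
    (K ℚ.+ a ℚ.* a) ℚ.* d ℚ.* ι ℚ.- K ℚ.* ι ℚ.* d
      ≡⟨ cong₂ (λ p q → p ℚ.* ι ℚ.- q ℚ.* d) Dd Kι ⟩
    1ℚ ℚ.* ι ℚ.- 1ℚ ℚ.* d
      ≡⟨ cong₂ ℚ._-_ (ℚ.*-identityˡ ι) (ℚ.*-identityˡ d) ⟩
    ι ℚ.- d ∎

  d≤ι : d ℚ.≤ ι
  d≤ι = 0≤q-p⇒p≤q (subst (0ℚ ℚ.≤_) ι-d (0≤* (0≤* (0≤p*p a) 0≤d) 0≤ι))

  coefficient≤Mι : (M ℚ.- K) ℚ.* d ℚ.+ 1ℚ ℚ.- K ℚ.* μ ℚ.≤ M ℚ.* ι
  coefficient≤Mι = begin
    (M ℚ.- K) ℚ.* d ℚ.+ 1ℚ ℚ.- K ℚ.* μ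
      ≤⟨ ℚ.+-monoʳ-≤ ((M ℚ.- K) ℚ.* d ℚ.+ 1ℚ) (ℚ.neg-antimono-≤ (0≤* 0≤K 0≤μ)) ⟩
    (M ℚ.- K) ℚ.* d ℚ.+ 1ℚ ℚ.+ 0ℚ
      ≡⟨ ℚ.+-identityʳ _ ⟩
    (M ℚ.- K) ℚ.* d ℚ.+ 1ℚ
      ≤⟨ ℚ.+-monoˡ-≤ 1ℚ (ℚ.*-monoˡ-≤-nonNeg (M ℚ.- K) {{ℚ.nonNegative (p≤q⇒0≤q-p K≤M)}} d≤ι) ⟩
    (M ℚ.- K) ℚ.* ι ℚ.+ 1ℚ
      ≡⟨ cong ((M ℚ.- K) ℚ.* ι ℚ.+_) (≡.sym Kι) ⟩
    (M ℚ.- K) ℚ.* ι ℚ.+ K ℚ.* ι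
      ≡⟨ solve 3 (λ M K ι → (M :- K) :* ι :+ K :* ι := M :* ι) ≡.refl M K ι ⟩
    M ℚ.* ι ∎

-- Passage from rational terms to real numbers

near-zero : ∀ {q ε} → q ≡ 0ℚ → 0ℚ ℚ.< ε → dist q 0ℚ ℚ.< ε
near-zero ≡.refl 0<ε = 0<ε

≈-pointwise : ∀ x y → (∀ N → seq x N ≡ seq y N) → x ≈ y
≈-pointwise x y eq ε 0<ε = 0 , λ N _ → subst (ℚ._< ε)
  (≡.sym (≡.trans (cong (λ q → ℚ.∣ seq x N ℚ.- q ∣) (≡.sym (eq N))) (cong ℚ.∣_∣ (ℚ.+-inverseʳ (seq x N))))) 0<ε

-- The order on the reals asks for a strict inequality with slack `ε` at an index. Here `p′` and
-- `q′` stand for terms of real norms, and `p` and `q` for their rational values.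
≤⇒<+ε : ∀ {c p q p′ q′ ε} → c ℚ.* p ℚ.≤ q → p′ ≡ p → q′ ≡ q → 0ℚ ℚ.< ε → c ℚ.* p′ ℚ.< q′ ℚ.+ ε
≤⇒<+ε {c} {p} {q} {ε = ε} cp≤q ≡.refl ≡.refl 0<ε =
  subst (ℚ._< q ℚ.+ ε) (ℚ.+-identityʳ (c ℚ.* p)) (ℚ.+-mono-≤-< cp≤q 0<ε)

seq-sum : ∀ {n} (f : Vector ℝ n) N → seq (Σℝ.sum f) N ≡ Σℚ.sum (λ i → seq (f i) N)
seq-sum {zero}  f N = ≡.refl
seq-sum {suc n} f N = cong (seq (f zero) N ℚ.+_) (seq-sum (f ∘ suc) N)

seq-sum-sum : ∀ {r c} (f : Fin r → Vector ℝ c) N →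
  seq (Σℝ.sum λ i → Σℝ.sum (f i)) N ≡ Σℚ.sum λ i → Σℚ.sum λ j → seq (f i j) N
seq-sum-sum {r} f N = ≡.trans (seq-sum {r} _ N) (Σℚ.sum-cong-≋ {r} λ i → seq-sum (f i) N)

1≉0 : ¬ 1ℝ ≈ 0ℝ
1≉0 1≈0 = let N , close = 1≈0 1ℚ (ℚ.positive⁻¹ 1ℚ) in ℚ.<-irrefl ≡.refl (close N ℕ.≤-refl)

-- The conclusion on x is what a real relation gives at one index of its Cauchy sequences.
independent⇒surjective : ∀ {n c} {B : Matℚ.Matrix n c} {r : Fin c → Fin n} → Incℚ.IsIncidence B r →
  (f : Fin n → Fin c) →
  (∀ (x : Vector ℚ n) → (∀ i → Σℚ.sum (λ j → x j ℚ.* B i (f j)) ≡ 0ℚ) → ∀ j → dist (x j) 0ℚ ℚ.< 1ℚ) →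
  ∀ i → ∃ λ j → r j ≡ i
independent⇒surjective {r = r} isIncidence f independent i =
  let j , eq = injective⇒preimage injective i in f j , eq
  where
  injective : Injective _≡_ _≡_ (r ∘ f)
  injective {a} {b} eq with a Fin.≟ b
  ... | yes a≡b = a≡b
  ... | no a≢b  = contradiction
    (subst (λ q → dist q 0ℚ ℚ.< 1ℚ) (Incℚ.difference-on a≢b)
      (independent (Incℚ.difference a b) (Incℚ.equal-columns⇒relation isIncidence f eq) a))
    (ℚ.<-irrefl ≡.refl)

-- Rational incidence matrices as real matrices, and their pseudo-inverses

module RealIncidence {n c} {B : Matℚ.Matrix n c} {r : Fin c → Fin n}
                     (isIncidence : Incℚ.IsIncidence B r) where

  private
    module B = Incℚ.IsIncidence isIncidence

    0≤B : ∀ i j → 0ℚ ℚ.≤ B i j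
    0≤B i j with r j Fin.≟ i
    ... | yes eq = subst (0ℚ ℚ.≤_) (≡.sym (B.on eq)) (ℚ.nonNegative⁻¹ 1ℚ)
    ... | no ne  = subst (0ℚ ℚ.≤_) (≡.sym (B.off ne)) ℚ.≤-refl

  matrix : Matrix n c
  matrix i j = fromℚ (B i j)

  matrix-isIncidence : Incℝ.IsIncidence matrix r
  matrix-isIncidence = record
    { on  = λ {i} {j} eq → ≈-pointwise (matrix i j) 1ℝ λ _ → B.on eq
    ; off = λ {i} {j} ne → ≈-pointwise (matrix i j) 0ℝ λ _ → B.off ne
    }

  rowSum : Vector ℚ n
  rowSum i = Σℚ.sum (B i)

  sum-rowSum : Σℚ.sum rowSum ≡ + c ℚ./ 1
  sum-rowSum = ≡.trans (Incℚ.entrySum isIncidence) (sum-ones c)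

  module _ (surjective : ∀ i → ∃ λ j → r j ≡ i) where

    -- Surjectivity puts a 1 into row `i`, and the other entries are nonnegative.
    rowSum-pos : ∀ i → 0ℚ ℚ.< rowSum i
    rowSum-pos i = let j , rj≡i = surjective i in
      ℚ.<-≤-trans (ℚ.positive⁻¹ 1ℚ) (subst (ℚ._≤ rowSum i) (B.on rj≡i) (term≤sum (0≤B i) j))

    weight : Vector ℚ n
    weight i = invℚ (rowSum i)

    rowSum*weight : ∀ i → rowSum i ℚ.* weight i ≡ 1ℚ
    rowSum*weight i = invℚ-inverse (rowSum-pos i)

    pseudoInverse : Matrix c n
    pseudoInverse = Incℝ.weightedTranspose matrix (fromℚ ∘ weight)

    pseudoInverse-isPseudoInverse : IsPseudoInverse matrix pseudoInverse
    pseudoInverse-isPseudoInverse = Incℝ.weightedTranspose-isPseudoInverse matrix-isIncidence {fromℚ ∘ weight} weight-inverse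
      where
      weight-inverse : ∀ i → Σℝ.sum (matrix i) * fromℚ (weight i) ≈ 1ℝ
      weight-inverse i = ≈-pointwise (Σℝ.sum (matrix i) * fromℚ (weight i)) 1ℝ λ N →
        ≡.trans (cong (ℚ._* weight i) (seq-sum (matrix i) N)) (rowSum*weight i)

    -- Stated over the rationals because the entries are constant sequences: this is the value of
    -- every term of the real norm.
    ‖pseudoInverse‖F² : Matℚ.‖ Incℚ.weightedTranspose B weight ‖F² ≡ Σℚ.sum weight
    ‖pseudoInverse‖F² = Incℚ.‖weightedTranspose‖F² isIncidence rowSum*weight

-- The matrix of repeated identity blocks

theorem4p5 : ∀ (α : ℝ) (α>0 : 0ℝ < α) (n m k : ℕ) .{{_ : NonZero n}} →
    n ℕ.< m → n ∣ m → 2 ℕ.< m ℕ./ n → n ℕ.≤ k → k ℕ.≤ m →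
    Σ[ X ∈ Matrix n m ] FullRank X ×
    (Σ[ X† ∈ Matrix m n ] IsPseudoInverse X X† ×
    (∀ (S : Subset m) → ∣ S ∣ ≡ k → HasRank (columns X S) n →
    Σ[ XS† ∈ Matrix ∣ S ∣ n ] IsPseudoInverse (columns X S) XS† ×
    (((fromℕ m - fromℕ k) / (fromℕ k + α ²) ⟨ fromℕ+²>0 k α α>0 ⟩
    + 1ℝ - fromℕ k / fromℕ n ⟨ fromℕ>0 n ⟩) * ‖ X† ‖F²
    ≤ ‖ XS† ‖F²)))
theorem4p5 α α>0 n _ k n<m (divides zero    ≡.refl) _ n≤k k≤m = contradiction n<m ℕ.n≮0
theorem4p5 α α>0 n _ k n<m (divides (suc l) ≡.refl) _ n≤k k≤m =
  X.matrix ,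
  subst (HasRank X.matrix) (≡.sym (ℕ.m≤n⇒m⊓n≡m (ℕ.<⇒≤ n<m)))
    -- The columns of the first block, `combine zero i`, already form an identity matrix.
    (Incℝ.section⇒hasRank X.matrix-isIncidence 1≉0 (combine {suc l} zero) λ i → proj₂ (label-surjective i)) ,
  X.pseudoInverse label-surjective ,
  X.pseudoInverse-isPseudoInverse label-surjective ,
  -- The proofs over ℝ are given termwise in ℚ, because comparing independence or order
  -- statements between compound reals makes Agda unfold their Cauchy moduli.
  λ S ∣S∣≡k ((f , independent) , _) →
    -- The `n` independent columns supplied by the rank are tested on constant sequences. Reading
    -- the result at tolerance 1 gives a coefficient of absolute value below 1, enough to exclude
    -- the coefficient 1 of a repeated column.
    let surjective = independent⇒surjective (Incℚ.columns-isIncidence isIncidence S) f λ x x·B≡0 j →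
          let N , close = independent (fromℚ ∘ x)
                (λ i ε 0<ε → 0 , λ N _ → near-zero (≡.trans (seq-sum {n} _ N) (x·B≡0 i)) 0<ε)
                j 1ℚ (ℚ.positive⁻¹ 1ℚ)
          in close N ℕ.≤-refl
    in XS.pseudoInverse S surjective , XS.pseudoInverse-isPseudoInverse S surjective ,
       -- The threshold is 0 because `bound` holds at every index: `K > 0` keeps `K + a²` positive
       -- for each rational term `a` of `α`, so `invℚ` is a true reciprocal there.
       λ ε 0<ε → 0 , λ N _ → ≤⇒<+ε {coefficient (seq α N)} (bound S ∣S∣≡k surjective (seq α N))
         (≡.trans (seq-sum-sum {suc l ℕ.* n} {n} _ N) (X.‖pseudoInverse‖F² label-surjective))
         (≡.trans (seq-sum-sum {∣ S ∣} {n} _ N) (XS.‖pseudoInverse‖F² S surjective)) 0<ε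
  where
  instance
    k≢0 : NonZero k
    k≢0 = ℕ.>-nonZero (ℕ.<-≤-trans (ℕ.>-nonZero⁻¹ n) n≤k)

  -- Column `combine a b` gets label `b`, so each block `a` of `n` consecutive columns is an
  -- identity matrix.
  label : Fin (suc l ℕ.* n) → Fin n
  label = proj₂ ∘ remQuot {suc l} n

  label-surjective : ∀ i → ∃ λ j → label j ≡ i
  label-surjective i = combine {suc l} zero i , cong proj₂ (Fin.remQuot-combine {suc l} zero i)

  isIncidence : Incℚ.IsIncidence (Incℚ.incidence label) label
  isIncidence = Incℚ.incidence-isIncidence label

  module X = RealIncidence isIncidence

  N̂ K M L t : ℚ
  N̂ = + n ℚ./ 1
  K = + k ℚ./ 1
  M = + (suc l ℕ.* n) ℚ./ 1
  L = Σℚ.sum {suc l} (λ _ → 1ℚ)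
  -- The tangent point `n/k` is the average of the row sums of `X_S`, inverted; there the tangent
  -- bound equals `n²/k`.
  t = N̂ ℚ.* invℚ K

  coefficient : ℚ → ℚ
  coefficient a = (M ℚ.- K) ℚ.* invℚ (K ℚ.+ a ℚ.* a) ℚ.+ 1ℚ ℚ.- K ℚ.* invℚ N̂

  0<N̂ : 0ℚ ℚ.< N̂
  0<N̂ = /1-pos n
  0<K : 0ℚ ℚ.< K
  0<K = /1-pos k
  0<L : 0ℚ ℚ.< L
  0<L = subst (0ℚ ℚ.<_) (≡.sym (sum-ones (suc l))) (/1-pos (suc l))

  rowSum≡L : ∀ i → X.rowSum i ≡ L
  rowSum≡L = Incℚ.rowSum-remainder (suc l) isIncidence

  sum-const : ∀ x → Σℚ.sum {n} (λ _ → x) ≡ N̂ ℚ.* x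
  sum-const x = ≡.trans (≡.sym (Incℚ.sum-ones-* {n} x)) (cong (ℚ._* x) (sum-ones n))

  -- Double counting of the ones of `X`: `n` rows with `L` ones each, and one for each of the `m`
  -- columns.
  N̂L≡M : N̂ ℚ.* L ≡ M
  N̂L≡M = ≡.trans (≡.sym (sum-const L))
    (≡.trans (≡.sym (Σℚ.sum-cong-≋ {n} rowSum≡L)) X.sum-rowSum)

  sum-weight : Σℚ.sum (X.weight label-surjective) ≡ N̂ ℚ.* invℚ L
  sum-weight = ≡.trans (Σℚ.sum-cong-≋ {n} (cong invℚ ∘ rowSum≡L)) (sum-const (invℚ L))

  module XS (S : Subset (suc l ℕ.* n)) = RealIncidence (Incℚ.columns-isIncidence isIncidence S)

  -- Each selected column contains a single 1, so the row sums of `X_S` add up to the size of `S`,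
  -- which is `k`.
  tangent : ∀ S → ∣ S ∣ ≡ k → (surjective : ∀ i → ∃ λ j → label (enum S j) ≡ i) →
            N̂ ℚ.* (t ℚ.+ t) ℚ.- t ℚ.* t ℚ.* K ℚ.≤ Σℚ.sum (XS.weight S surjective)
  tangent S ∣S∣≡k surjective = subst (λ c → N̂ ℚ.* (t ℚ.+ t) ℚ.- t ℚ.* t ℚ.* c ℚ.≤ Σℚ.sum (XS.weight S surjective))
    (≡.trans (XS.sum-rowSum S) (cong (λ c → + c ℚ./ 1) ∣S∣≡k))
    (sum-reciprocals-tangent t (ℚ.<⇒≤ ∘ XS.rowSum-pos S surjective) (XS.rowSum*weight S surjective))

  bound : ∀ S → ∣ S ∣ ≡ k → (surjective : ∀ i → ∃ λ j → label (enum S j) ≡ i) → ∀ a →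
          coefficient a ℚ.* Σℚ.sum (X.weight label-surjective)
          ℚ.≤ Σℚ.sum (XS.weight S surjective)
  bound S ∣S∣≡k surjective a = subst (λ p → coefficient a ℚ.* p ℚ.≤ Σℚ.sum (XS.weight S surjective)) (≡.sym sum-weight)
    (coefficient-bound {N̂} {K} {M} {L} {invℚ L} {a}
      (ℚ.<⇒≤ 0<N̂) (ℚ.<⇒≤ 0<K) (/1-mono-≤ k≤m) (ℚ.<⇒≤ 0<L)
      (invℚ-inverse 0<K) (invℚ-inverse 0<N̂)
      (invℚ-inverse (ℚ.+-mono-<-≤ 0<K (0≤p*p a)))
      N̂L≡M (invℚ-inverse 0<L)
      (tangent S ∣S∣≡k surjective))
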